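{- As formal power series, $$\sum_{M\geq1}g(M)x^M=\frac{x-x^3}{(1-x-x^2)^2},\qquad \sum_{M\geq1}h(M)x^M=\frac{x-x^2}{(1-x-x^2)^2},$$ $$\sum_{M\geq1}g_1(M)x^M=\frac{x^2}{(1-x-x^2)^2}=\sum_{M\geq1}h_1(M)x^M.$$ In particular $g_1(M)=h_1(M)$ for all $M\geq1$.
   Context: The perimeter of a nonempty partition $\lambda$ with largest part $\lambda_1$ and $\ell(\lambda)$ parts is $\lambda_1+\ell(\lambda)-1$. $\mathcal G(M)$ is the set of partitions into odd parts with perimeter $M$, $\mathcal H(M)$ the set of partitions into distinct parts with perimeter $M$; $g(M)$ (resp. $h(M)$) is the total number of parts, summed over all partitions in $\mathcal G(M)$ (resp. $\mathcal H(M)$). $\mathcal G_1(M)$ is the set of partitions with perimeter $M$ in which exactly one distinct even integer occurs as a part (possibly with multiplicity greater than one) and all other parts are odd; $\mathcal H_1(M)$ is the set of partitions with perimeter $M$ in which exactly one part value occurs at least twice and every other part value occurs exactly once. $g_1(M)=|\mathcal G_1(M)|$, $h_1(M)=|\mathcal H_1(M)|$. -}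

module Defs where

open import Data.Empty using (⊥)
open import Data.Integer.Base as ℤ using (ℤ; +_; 0ℤ; 1ℤ)
import Data.Integer.Properties as ℤ
open import Data.List.Base using (List; []; _∷_; length; map; filter; concatMap; upTo)
open import Data.List.Membership.Propositional using (_∈_; find; lose)
open import Data.List.Membership.Propositional.Properties using (∈-map⁺; ∈-map⁻; ∈-concatMap⁺; ∈-concatMap⁻; ∈-filter⁺; ∈-filter⁻; ∈-upTo⁺; ∈-upTo⁻)
open import Data.List.Properties using (∷-injectiveˡ; ∷-injectiveʳ)
open import Data.List.Relation.Unary.All as All using (All; []; _∷_)
import Data.List.Relation.Unary.All.Properties as All
import Data.List.Relation.Unary.AllPairs as AllPairs
import Data.List.Relation.Unary.AllPairs.Properties as AllPairs
open import Data.List.Relation.Unary.Any using (here; any?)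
open import Data.List.Relation.Unary.Linked using (Linked; []; [-]; _∷_)
open import Data.List.Relation.Unary.Unique.Propositional using (Unique)
import Data.List.Relation.Unary.Unique.Propositional.Properties as Unique
open import Data.Nat.Base as ℕ using (ℕ; zero; suc; _∸_; _≤_; _<_; _≥_; z≤n; s≤s)
open import Data.Nat.Divisibility using (_∣_; _∣?_)
open import Data.Nat.ListAction using (sum)
import Data.Nat.Properties as ℕ
open import Data.List.Relation.Unary.Unique.DecPropositional ℕ._≟_ using (unique?)
open import Data.Product.Base using (∃; _×_; _,_)
open import Function.Base using (_∘_)
open import Function.Bundles using (_⇔_; mk⇔; module Equivalence)
open import Relation.Binary.PropositionalEquality using (_≡_; _≢_; _≗_; refl; sym; trans; cong; module ≡-Reasoning)
open import Relation.Nullary using (¬_)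
open import Relation.Nullary.Decidable using (True; toWitness; map′; ¬?; _×-dec_; _→-dec_)
open import Relation.Unary using (Pred; Decidable)
open import Level using (0ℓ)

record IsPartition (ps : List ℕ) : Set where
  constructor _,_
  field
    decreasing : Linked _≥_ ps
    positive   : All (0 <_) ps

-- The head of a weakly decreasing list is its largest part; the empty
-- partition has no perimeter.
HasPerimeter : ℕ → List ℕ → Set
HasPerimeter M []       = ⊥
HasPerimeter M (p ∷ ps) = p ℕ.+ length (p ∷ ps) ∸ 1 ≡ M

PartitionOfPerimeter : ℕ → List ℕ → Set
PartitionOfPerimeter M ps = IsPartition ps × HasPerimeter M ps

Even Odd : ℕ → Set
Even n = 2 ∣ n
Odd n  = ¬ Even n

multiplicity : ℕ → List ℕ → ℕ
multiplicity v ps = length (filter (v ℕ.≟_) ps)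

OneEvenPart : List ℕ → Set
OneEvenPart ps = ∃ λ e → e ∈ ps × Even e × All (λ p → p ≢ e → Odd p) ps

OneRepeatedPart : List ℕ → Set
OneRepeatedPart ps = ∃ λ v → v ∈ ps × 2 ≤ multiplicity v ps × All (λ p → p ≢ v → multiplicity p ps ≡ 1) ps

𝒢 ℋ 𝒢₁ ℋ₁ : ℕ → List ℕ → Set
𝒢  M ps = PartitionOfPerimeter M ps × All Odd ps
ℋ  M ps = PartitionOfPerimeter M ps × Unique ps
𝒢₁ M ps = PartitionOfPerimeter M ps × OneEvenPart ps
ℋ₁ M ps = PartitionOfPerimeter M ps × OneRepeatedPart ps

record Enumeration (P : Pred (List ℕ) 0ℓ) : Set where
  field
    elements : List (List ℕ)
    unique   : Unique elements
    exact    : ∀ ps → ps ∈ elements ⇔ P ps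

  cardinality : ℕ
  cardinality = length elements

  totalOf : (List ℕ → ℕ) → ℕ
  totalOf f = sum (map f elements)

restrict : ∀ {P Q : Pred (List ℕ) 0ℓ} → Enumeration P → Decidable Q → Enumeration (λ ps → P ps × Q ps)
restrict E Q? = record
  { elements = filter Q? elements
  ; unique   = Unique.filter⁺ Q? unique
  ; exact    = λ ps → mk⇔
      (λ i → let (j , q) = ∈-filter⁻ Q? i in Equivalence.to (exact ps) j , q)
      (λ (p , q) → ∈-filter⁺ Q? (Equivalence.from (exact ps) p) q)
  }
  where open Enumeration E

-- All lists (suc i ∷ ps) with i < n and ps drawn from f i.
consUpTo : ℕ → (ℕ → List (List ℕ)) → List (List ℕ)
consUpTo n f = concatMap (λ i → map (suc i ∷_) (f i)) (upTo n)

-- Partitions with exactly k parts, all at most b.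
bounded : (b k : ℕ) → List (List ℕ)
bounded b zero    = [] ∷ []
bounded b (suc k) = consUpTo b (λ i → bounded (suc i) k)

-- A partition of perimeter M and largest part suc i has M ∸ suc i further parts.
ofPerimeter : ℕ → List (List ℕ)
ofPerimeter M = consUpTo M (λ i → bounded (suc i) (M ∸ suc i))

consUpTo⁺ : ∀ {n f i ps} → i < n → ps ∈ f i → suc i ∷ ps ∈ consUpTo n f
consUpTo⁺ i<n ps∈ = ∈-concatMap⁺ _ (lose (∈-upTo⁺ i<n) (∈-map⁺ _ ps∈))

consUpTo⁻ : ∀ {n f qs} → qs ∈ consUpTo n f → ∃ λ i → ∃ λ ps → i < n × ps ∈ f i × qs ≡ suc i ∷ ps
consUpTo⁻ qs∈ =
  let (i , i∈ , qs∈′) = find (∈-concatMap⁻ _ qs∈)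
      (ps , ps∈ , eq) = ∈-map⁻ _ qs∈′
  in i , ps , ∈-upTo⁻ i∈ , ps∈ , eq

consUpTo-unique : ∀ n {f} → (∀ i → Unique (f i)) → Unique (consUpTo n f)
consUpTo-unique n {f} uf = Unique.concat⁺
  (All.map⁺ (All.universal (λ i → Unique.map⁺ ∷-injectiveʳ (uf i)) (upTo n)))
  (AllPairs.map⁺ (AllPairs.map disjoint (Unique.upTo⁺ n)))
  where
  disjoint : ∀ {i j} → i ≢ j → ∀ {qs} → ¬ (qs ∈ map (suc i ∷_) (f i) × qs ∈ map (suc j ∷_) (f j))
  disjoint i≢j (a , b) =
    let (_ , _ , p) = ∈-map⁻ _ a
        (_ , _ , q) = ∈-map⁻ _ b
    in i≢j (ℕ.suc-injective (∷-injectiveˡ (trans (sym p) q)))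

bounded-unique : ∀ b k → Unique (bounded b k)
bounded-unique b zero    = [] AllPairs.∷ AllPairs.[]
bounded-unique b (suc k) = consUpTo-unique b (λ i → bounded-unique (suc i) k)

-- Putting the bound in front as a head expresses "all parts at most b".
bounded-sound : ∀ b k {ps} → ps ∈ bounded (suc b) k → IsPartition (suc b ∷ ps) × length ps ≡ k
bounded-sound b zero (here refl) = ([-] , (s≤s z≤n ∷ [])) , refl
bounded-sound b (suc k) ps∈ with consUpTo⁻ {n = suc b} ps∈
... | i , qs , i<b , qs∈ , refl with bounded-sound i k qs∈
... | (d , pos) , len = ((i<b ∷ d) , (s≤s z≤n ∷ pos)) , cong suc len

bounded-complete : ∀ b {ps} → IsPartition (b ∷ ps) → ps ∈ bounded b (length ps)
bounded-complete b {[]} _ = here refl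
bounded-complete b {zero ∷ ps} (_ , (_ ∷ () ∷ _))
bounded-complete b {suc i ∷ ps} ((i<b ∷ d) , (_ ∷ pos)) = consUpTo⁺ {n = b} i<b (bounded-complete (suc i) (d , pos))

perimeter-cons : ∀ p (ps : List ℕ) → p ℕ.+ length (p ∷ ps) ∸ 1 ≡ p ℕ.+ length ps
perimeter-cons p ps = cong (_∸ 1) (ℕ.+-suc p (length ps))

partitionsOfPerimeter : ∀ M → Enumeration (PartitionOfPerimeter M)
partitionsOfPerimeter M = record
  { elements = ofPerimeter M
  ; unique   = consUpTo-unique M (λ i → bounded-unique (suc i) (M ∸ suc i))
  ; exact    = λ ps → mk⇔ (to ps) (from ps)
  }
  where
  to : ∀ ps → ps ∈ ofPerimeter M → PartitionOfPerimeter M ps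
  to ps ps∈ with consUpTo⁻ {n = M} ps∈
  ... | i , qs , i<M , qs∈ , refl with bounded-sound i (M ∸ suc i) qs∈
  ... | part , len = part , trans (perimeter-cons (suc i) qs) (trans (cong (suc i ℕ.+_) len) (ℕ.m+[n∸m]≡n i<M))

  from : ∀ ps → PartitionOfPerimeter M ps → ps ∈ ofPerimeter M
  from (suc i ∷ ps) (part , refl) rewrite ℕ.+-suc i (length ps) =
    consUpTo⁺ {n = suc (i ℕ.+ length ps)} (s≤s (ℕ.m≤m+n i (length ps))) member
    where
    member : ps ∈ bounded (suc i) (i ℕ.+ length ps ∸ i)
    member rewrite ℕ.m+n∸m≡n i (length ps) = bounded-complete (suc i) part
  from (zero ∷ ps) ((_ , (() ∷ _)) , _)

odd? : Decidable Odd
odd? n = ¬? (2 ∣? n)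

oneEvenPart? : Decidable OneEvenPart
oneEvenPart? ps = map′ find (λ (_ , e∈ , r) → lose e∈ r)
  (any? (λ e → (2 ∣? e) ×-dec All.all? (λ p → ¬? (p ℕ.≟ e) →-dec odd? p) ps) ps)

oneRepeatedPart? : Decidable OneRepeatedPart
oneRepeatedPart? ps = map′ find (λ (_ , v∈ , r) → lose v∈ r)
  (any? (λ v → (2 ℕ.≤? multiplicity v ps) ×-dec
    All.all? (λ p → ¬? (p ℕ.≟ v) →-dec (multiplicity p ps ℕ.≟ 1)) ps) ps)

enum-𝒢 : ∀ M → Enumeration (𝒢 M)
enum-𝒢 M = restrict (partitionsOfPerimeter M) (All.all? odd?)

enum-ℋ : ∀ M → Enumeration (ℋ M)
enum-ℋ M = restrict (partitionsOfPerimeter M) unique?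

enum-𝒢₁ : ∀ M → Enumeration (𝒢₁ M)
enum-𝒢₁ M = restrict (partitionsOfPerimeter M) oneEvenPart?

enum-ℋ₁ : ∀ M → Enumeration (ℋ₁ M)
enum-ℋ₁ M = restrict (partitionsOfPerimeter M) oneRepeatedPart?

g h g₁ h₁ : ℕ → ℕ
g  M = Enumeration.totalOf (enum-𝒢 M) length
h  M = Enumeration.totalOf (enum-ℋ M) length
g₁ M = Enumeration.cardinality (enum-𝒢₁ M)
h₁ M = Enumeration.cardinality (enum-ℋ₁ M)

PowerSeries : Set
PowerSeries = ℕ → ℤ

infixl 6 _-_
infixl 7 _*_ _/_
infixr 8 _^_

-- ∑≤ n f = f 0 + ⋯ + f n
∑≤ : ℕ → (ℕ → ℤ) → ℤ
∑≤ zero    f = f 0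
∑≤ (suc n) f = f 0 ℤ.+ ∑≤ n (f ∘ suc)

one : PowerSeries
one zero    = 1ℤ
one (suc _) = 0ℤ

X : PowerSeries
X 1 = 1ℤ
X _ = 0ℤ

_-_ : PowerSeries → PowerSeries → PowerSeries
(F - G) n = F n ℤ.- G n

_*_ : PowerSeries → PowerSeries → PowerSeries
(F * G) n = ∑≤ n (λ k → F k ℤ.* G (n ∸ k))

_^_ : PowerSeries → ℕ → PowerSeries
F ^ zero  = one
F ^ suc n = F * F ^ n

-- Σ_{M ≥ 1} a(M) x^M
∑≥1 : (ℕ → ℕ) → PowerSeries
∑≥1 a zero    = 0ℤ
∑≥1 a (suc n) = + a (suc n)

dot : PowerSeries → List ℤ → ℤ
dot G []       = 0ℤ
dot G (r ∷ rs) = G 0 ℤ.* r ℤ.+ dot (G ∘ suc) rs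

-- The coefficients r_{n-1}, …, r_0 of the quotient R = F / G, where
-- r_n = F n - Σ_{k<n} G (1+k) r_{n-1-k}  since G 0 = 1.
quotientCoeffs : PowerSeries → PowerSeries → ℕ → List ℤ
quotientCoeff  : PowerSeries → PowerSeries → ℕ → ℤ

quotientCoeffs F G zero    = []
quotientCoeffs F G (suc n) = quotientCoeff F G n ∷ quotientCoeffs F G n

quotientCoeff F G n = F n ℤ.- dot (G ∘ suc) (quotientCoeffs F G n)

_/_ : (F G : PowerSeries) → {True (G 0 ℤ.≟ 1ℤ)} → PowerSeries
F / G = quotientCoeff F G

dot-quotientCoeffs : ∀ F G H n → dot H (quotientCoeffs F G (suc n)) ≡ (H * quotientCoeff F G) n
dot-quotientCoeffs F G H zero    = ℤ.+-identityʳ _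
dot-quotientCoeffs F G H (suc n) = cong (λ z → H 0 ℤ.* quotientCoeff F G (suc n) ℤ.+ z) (dot-quotientCoeffs F G (H ∘ suc) n)

/-correct : ∀ F G {G₀ : True (G 0 ℤ.≟ 1ℤ)} → G * (_/_ F G {G₀}) ≗ F
/-correct F G {G₀} n = begin
  (G * R) n                                             ≡⟨ dot-quotientCoeffs F G G n ⟨
  G 0 ℤ.* R n ℤ.+ d                                     ≡⟨ cong (λ z → z ℤ.* R n ℤ.+ d) (toWitness G₀) ⟩
  1ℤ ℤ.* R n ℤ.+ d                                      ≡⟨ cong (ℤ._+ d) (ℤ.*-identityˡ (R n)) ⟩
  (F n ℤ.- d) ℤ.+ d                                     ≡⟨ ℤ.+-assoc (F n) (ℤ.- d) d ⟩
  F n ℤ.+ (ℤ.- d ℤ.+ d)                                 ≡⟨ cong (λ z → F n ℤ.+ z) (ℤ.+-inverseˡ d) ⟩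
  F n ℤ.+ 0ℤ                                            ≡⟨ ℤ.+-identityʳ (F n) ⟩
  F n                                                   ∎
  where
  open ≡-Reasoning
  R : PowerSeries
  R = quotientCoeff F G
  d : ℤ
  d = dot (G ∘ suc) (quotientCoeffs F G n)

{-# OPTIONS --safe #-}
-- A partition of perimeter M + 1 ≥ 2 arises from a unique partition of perimeter M,
-- by raising the largest part by one or by repeating it.  All-odd partitions are built
-- from (1) by repeating (perimeter + 1) or raising twice (+ 2); distinct partitions by
-- raising (+ 1) or repeating and then raising (+ 2); both counts are Fibonacci numbers f.
-- For 𝒢₁ and ℋ₁, let b count the partitions whose largest part is the even
-- (respectively repeated) value and a the others; both cases give
-- b(M+1) = b(M) + f(M) and a(M+2) = a(M+1) + a(M) + b(M).  All four sequences thus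
-- satisfy a Fibonacci recurrence with a Fibonacci inhomogeneity, and (1 - x - x²)²
-- annihilates them up to an explicit numerator.

module Submission where

open import Algebra.Bundles using (AbelianGroup)
open import Algebra.Properties.Group using (∙-cancelʳ)
open import Data.Bool.Base using (true; false; if_then_else_)
open import Data.Integer.Base as ℤ using (ℤ; +_; 0ℤ; 1ℤ; -1ℤ)
import Data.Integer.Properties as ℤ
import Data.Integer.Tactic.RingSolver as ℤRing
open import Data.List.Base using (List; []; _∷_; _++_; _∷ʳ_; length; map; filter; concatMap; upTo; applyUpTo)
open import Data.List.Membership.Propositional using (_∈_; _∉_)
open import Data.List.Properties using (map-++; map-∘; map-upTo; applyUpTo-∷ʳ; filter-accept; filter-reject; filter-none; filter-some)
open import Data.List.Relation.Unary.All as All using (All; []; _∷_)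
open import Data.List.Relation.Unary.All.Properties using (¬Any⇒All¬; All¬⇒¬Any)
open import Data.List.Relation.Unary.AllPairs using ([]; _∷_)
open import Data.List.Relation.Unary.Any using (here; there)
open import Data.List.Relation.Unary.Unique.Propositional using (Unique)
open import Data.Nat.Base as ℕ using (ℕ; zero; suc; _+_; _∸_; _≤_; _<_; _≥_; z≤n; s≤s)
open import Data.Nat.Divisibility using (_∣?_; ∣-refl; ∣1⇒≡1; ∣m∣n⇒∣m+n; ∣m+n∣m⇒∣n)
open import Data.Nat.Induction using (<-rec)
open import Data.Nat.ListAction using (sum)
open import Data.Nat.ListAction.Properties using (sum-++)
import Data.Nat.Properties as ℕ
import Data.Nat.Tactic.RingSolver as ℕRing
open import Data.List.Membership.DecPropositional ℕ._≟_ using (_∈?_)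
open import Data.List.Relation.Unary.Unique.DecPropositional ℕ._≟_ using (unique?)
open import Data.Product.Base using (_×_; _,_)
open import Data.Product.Function.NonDependent.Propositional using (_×-⇔_)
open import Function.Base using (_∘_)
open import Function.Bundles using (_⇔_; mk⇔; module Equivalence)
open import Function.Construct.Composition using (_⇔-∘_)
open import Function.Construct.Symmetry using (⇔-sym)
open import Relation.Binary.PropositionalEquality using (_≡_; _≢_; _≗_; refl; sym; trans; cong; cong₂; subst; module ≡-Reasoning)
open import Relation.Nullary using (¬_; Dec; does; yes; no; contradiction)
open import Relation.Nullary.Decidable using (True; toWitness; ¬?; _×-dec_; does-⇔; dec-false)
open import Relation.Unary using (Decidable)
open import Defs

open Equivalence using (to; from)

-- Sums over partitions of given perimeter

∑< : ℕ → (ℕ → ℕ) → ℕ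
∑< n φ = sum (applyUpTo φ n)

∑<-snoc : ∀ n φ → ∑< (suc n) φ ≡ ∑< n φ + φ n
∑<-snoc n φ = begin
  sum (applyUpTo φ (suc n))         ≡⟨ cong sum (applyUpTo-∷ʳ φ n) ⟨
  sum (applyUpTo φ n ∷ʳ φ n)        ≡⟨ sum-++ (applyUpTo φ n) _ ⟩
  ∑< n φ + (φ n + 0)                ≡⟨ cong (λ z → ∑< n φ + z) (ℕ.+-identityʳ (φ n)) ⟩
  ∑< n φ + φ n                      ∎
  where open ≡-Reasoning

∑<-cong : ∀ n {φ ψ} → (∀ i → i < n → φ i ≡ ψ i) → ∑< n φ ≡ ∑< n ψ
∑<-cong zero    eq = refl
∑<-cong (suc n) eq = cong₂ _+_ (eq 0 (s≤s z≤n)) (∑<-cong n (λ i i<n → eq (suc i) (s≤s i<n)))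

interchange : ∀ a b c d → (a + b) + (c + d) ≡ (a + c) + (b + d)
interchange = ℕRing.solve-∀

∑<-+ : ∀ n φ ψ → ∑< n (λ i → φ i + ψ i) ≡ ∑< n φ + ∑< n ψ
∑<-+ zero    φ ψ = refl
∑<-+ (suc n) φ ψ = trans (cong (λ z → φ 0 + ψ 0 + z) (∑<-+ n (φ ∘ suc) (ψ ∘ suc))) (interchange (φ 0) _ _ _)

sum-map-concatMap : ∀ {A B : Set} (w : B → ℕ) (f : A → List B) xs →
  sum (map w (concatMap f xs)) ≡ sum (map (λ x → sum (map w (f x))) xs)
sum-map-concatMap w f []       = refl
sum-map-concatMap w f (x ∷ xs) = begin
  sum (map w (f x ++ concatMap f xs))           ≡⟨ cong sum (map-++ w (f x) _) ⟩
  sum (map w (f x) ++ map w (concatMap f xs))   ≡⟨ sum-++ (map w (f x)) _ ⟩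
  sum (map w (f x)) + sum (map w (concatMap f xs))             ≡⟨ cong (_+_ _) (sum-map-concatMap w f xs) ⟩
  sum (map w (f x)) + sum (map (λ x → sum (map w (f x))) xs)   ∎
  where open ≡-Reasoning

sum-map-consUpTo : ∀ w n f →
  sum (map w (consUpTo n f)) ≡ ∑< n (λ i → sum (map (w ∘ (suc i ∷_)) (f i)))
sum-map-consUpTo w n f = begin
  sum (map w (consUpTo n f))                                     ≡⟨ sum-map-concatMap w _ (upTo n) ⟩
  sum (map (λ i → sum (map w (map (suc i ∷_) (f i)))) (upTo n))  ≡⟨ cong sum (map-upTo _ n) ⟩
  ∑< n (λ i → sum (map w (map (suc i ∷_) (f i))))                ≡⟨ ∑<-cong n (λ i _ → cong sum (sym (map-∘ (f i)))) ⟩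
  ∑< n (λ i → sum (map (w ∘ (suc i ∷_)) (f i)))                  ∎
  where open ≡-Reasoning

boundedSum : ℕ → ℕ → (List ℕ → ℕ) → ℕ
boundedSum b k w = sum (map w (bounded b k))

-- The lists with head exactly `suc b` form the last summand of the sum over heads; all other lists
-- have every part at most `b`.
boundedSum-split : ∀ b k w →
  boundedSum (suc b) (suc k) w ≡ boundedSum b (suc k) w + boundedSum (suc b) k (w ∘ (suc b ∷_))
boundedSum-split b k w = begin
  boundedSum (suc b) (suc k) w                          ≡⟨ sum-map-consUpTo w (suc b) (λ i → bounded (suc i) k) ⟩
  ∑< (suc b) φ                                          ≡⟨ ∑<-snoc b φ ⟩
  ∑< b φ + φ b                                          ≡⟨ cong (_+ φ b) (sum-map-consUpTo w b (λ i → bounded (suc i) k)) ⟨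
  boundedSum b (suc k) w + φ b                          ∎
  where
  open ≡-Reasoning
  φ : ℕ → ℕ
  φ i = boundedSum (suc i) k (w ∘ (suc i ∷_))

-- w i ps is the weight of the partition suc i ∷ ps.
Weight : Set
Weight = ℕ → List ℕ → ℕ

-- Pullbacks of a weight along the two moves that increase the perimeter by one.
raise double : Weight → Weight
raise  w i ps = w (suc i) ps
double w i ps = w i (suc i ∷ ps)

-- total w n is the sum of w over the partitions of perimeter n + 1, see sum-ofPerimeter.
total : Weight → ℕ → ℕ
total w zero    = w 0 []
total w (suc n) = total (raise w) n + total (double w) n

perimeterSum : Weight → ℕ → ℕ
perimeterSum w n = ∑< (suc n) (λ i → boundedSum (suc i) (n ∸ i) (w i))

-- Either the largest part is repeated (`δ`), or it exceeds all others and can be lowered by one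
-- (`ρ`, reindexed as `υ`); the one-part partition supplies the missing last term of `υ`.
perimeterSum-suc : ∀ w n → perimeterSum w (suc n) ≡ perimeterSum (raise w) n + perimeterSum (double w) n
perimeterSum-suc w n = begin
  ∑< (2 + n) φ                                  ≡⟨ ∑<-snoc (suc n) φ ⟩
  ∑< (suc n) φ + φ (suc n)                      ≡⟨ cong₂ _+_ (∑<-cong (suc n) split) last ⟩
  ∑< (suc n) (λ i → ρ i + δ i) + υ n            ≡⟨ cong (_+ υ n) (∑<-+ (suc n) ρ δ) ⟩
  -- `ρ 0` has computed to 0: no nonempty partition has all parts at most 0.
  (∑< n (ρ ∘ suc) + ∑< (suc n) δ) + υ n         ≡⟨ cong (λ z → z + ∑< (suc n) δ + υ n) (∑<-cong n shift) ⟩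
  (∑< n υ + ∑< (suc n) δ) + υ n                 ≡⟨ swap (∑< n υ) _ _ ⟩
  (∑< n υ + υ n) + ∑< (suc n) δ                 ≡⟨ cong (_+ ∑< (suc n) δ) (∑<-snoc n υ) ⟨
  ∑< (suc n) υ + ∑< (suc n) δ                   ∎
  where
  open ≡-Reasoning
  φ ρ δ υ : ℕ → ℕ
  φ i = boundedSum (suc i) (suc n ∸ i) (w i)
  ρ i = boundedSum i (suc (n ∸ i)) (w i)
  δ i = boundedSum (suc i) (n ∸ i) (double w i)
  υ i = boundedSum (suc i) (n ∸ i) (raise w i)
  split : ∀ i → i < suc n → φ i ≡ ρ i + δ i
  split i (s≤s i≤n) = trans (cong (λ k → boundedSum (suc i) k (w i)) (ℕ.+-∸-assoc 1 i≤n))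
                            (boundedSum-split i (n ∸ i) (w i))
  shift : ∀ i → i < n → ρ (suc i) ≡ υ i
  shift i i<n = cong (λ k → boundedSum (suc i) k (w (suc i))) (sym (ℕ.+-∸-assoc 1 i<n))
  -- The bounds differ, but with no further parts both sides are `w (suc n) []`.
  last : φ (suc n) ≡ υ n
  last = trans (cong (λ k → boundedSum (2 + n) k (w (suc n))) (ℕ.n∸n≡0 n))
               (sym (cong (λ k → boundedSum (suc n) k (w (suc n))) (ℕ.n∸n≡0 n)))
  swap : ∀ a b c → (a + b) + c ≡ (a + c) + b
  swap = ℕRing.solve-∀

perimeterSum≡total : ∀ w n → perimeterSum w n ≡ total w n
perimeterSum≡total w zero    = trans (ℕ.+-identityʳ _) (ℕ.+-identityʳ _)
perimeterSum≡total w (suc n) = trans (perimeterSum-suc w n)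
  (cong₂ _+_ (perimeterSum≡total (raise w) n) (perimeterSum≡total (double w) n))

sum-ofPerimeter : ∀ (w : List ℕ → ℕ) n → sum (map w (ofPerimeter (suc n))) ≡ total (λ i ps → w (suc i ∷ ps)) n
sum-ofPerimeter w n = trans (sum-map-consUpTo w (suc n) (λ i → bounded (suc i) (n ∸ i)))
                            (perimeterSum≡total (λ i ps → w (suc i ∷ ps)) n)

-- Only tails bounded by the largest part matter for a total.
_≈ʷ_ : Weight → Weight → Set
v ≈ʷ w = ∀ i ps → All (_≤ suc i) ps → v i ps ≡ w i ps

0ʷ : Weight
0ʷ _ _ = 0

_+ʷ_ : Weight → Weight → Weight
(v +ʷ w) i ps = v i ps + w i ps

-- Both moves keep the tail below the largest part: raising relaxes the bound, repeating adds a part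
-- that meets it.
total-cong : ∀ {v w} → v ≈ʷ w → ∀ n → total v n ≡ total w n
total-cong eq zero    = eq 0 [] []
total-cong eq (suc n) = cong₂ _+_
  (total-cong (λ i ps ps≤ → eq (suc i) ps (All.map ℕ.m≤n⇒m≤1+n ps≤)) n)
  (total-cong (λ i ps ps≤ → eq i (suc i ∷ ps) (ℕ.≤-refl ∷ ps≤)) n)

total-+ : ∀ v w n → total (v +ʷ w) n ≡ total v n + total w n
total-+ v w zero    = refl
total-+ v w (suc n) = trans (cong₂ _+_ (total-+ (raise v) (raise w) n) (total-+ (double v) (double w) n))
                            (interchange (total (raise v) n) _ _ _)

total-0 : ∀ n → total 0ʷ n ≡ 0
total-0 zero    = refl
total-0 (suc n) = cong₂ _+_ (total-0 n) (total-0 n)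

-- Unfolds `total` once, and its raised half once more. Suited to parity conditions, which two
-- raises restore; `v` and `s` are the corrections from repeat-then-raise and from repeat.
raise²-double-recurrence : ∀ {w v s} → raise (raise w) ≈ʷ w → double (raise w) ≈ʷ v → double w ≈ʷ (w +ʷ s) →
  ∀ n → total w (2 + n) ≡ total w (1 + n) + total w n + (total v n + total s (1 + n))
raise²-double-recurrence {w} {v} {s} raise² raise-double doubled n = begin
  (total (raise (raise w)) n + total (double (raise w)) n) + total (double w) (1 + n)
    ≡⟨ cong₂ _+_ (cong₂ _+_ (total-cong raise² n) (total-cong raise-double n)) (total-cong doubled (1 + n)) ⟩
  (total w n + total v n) + total (w +ʷ s) (1 + n)
    ≡⟨ cong (λ z → total w n + total v n + z) (total-+ w s (1 + n)) ⟩
  (total w n + total v n) + (total w (1 + n) + total s (1 + n))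
    ≡⟨ rearrange (total w n) (total v n) (total w (1 + n)) (total s (1 + n)) ⟩
  total w (1 + n) + total w n + (total v n + total s (1 + n)) ∎
  where
  open ≡-Reasoning
  rearrange : ∀ a b c d → (a + b) + (c + d) ≡ c + a + (b + d)
  rearrange = ℕRing.solve-∀

-- A repeated largest part kills `w`, so the last move is a raise; before it comes either another
-- raise, which only widens a gap, or a repeat.
raise-recurrence : ∀ {w v} → double w ≈ʷ 0ʷ → raise (raise w) ≈ʷ raise w → double (raise w) ≈ʷ (w +ʷ v) →
  ∀ n → total w (2 + n) ≡ total w (1 + n) + total w n + total v n
raise-recurrence {w} {v} doubled raise² raise-double n = begin
  total (raise w) (1 + n) + total (double w) (1 + n)
    ≡⟨ drop (1 + n) ⟩
  total (raise (raise w)) n + total (double (raise w)) n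
    ≡⟨ cong₂ _+_ (total-cong raise² n) (trans (total-cong raise-double n) (total-+ w v n)) ⟩
  total (raise w) n + (total w n + total v n)
    ≡⟨ cong (_+ (total w n + total v n)) (drop n) ⟨
  total w (1 + n) + (total w n + total v n)
    ≡⟨ ℕ.+-assoc (total w (1 + n)) _ _ ⟨
  total w (1 + n) + total w n + total v n ∎
  where
  open ≡-Reasoning
  drop : ∀ m → total w (suc m) ≡ total (raise w) m
  drop m = trans (cong (λ z → total (raise w) m + z) (trans (total-cong doubled m) (total-0 m))) (ℕ.+-identityʳ _)

-- Indicators

χ : ∀ {P : Set} → Dec P → ℕ
χ p? = if does p? then 1 else 0

χ-cong : ∀ {P Q : Set} (p? : Dec P) (q? : Dec Q) → P ⇔ Q → χ p? ≡ χ q?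
χ-cong p? q? P⇔Q = cong (if_then 1 else 0) (does-⇔ P⇔Q p? q?)

χ-no : ∀ {P : Set} (p? : Dec P) → ¬ P → χ p? ≡ 0
χ-no p? ¬p = cong (if_then 1 else 0) (dec-false p? ¬p)

χ-split : ∀ {P Q : Set} (q? : Dec Q) (p? : Dec P) → χ p? ≡ χ (q? ×-dec p?) + χ (¬? q? ×-dec p?)
χ-split q? p? with does q?
... | true  = sym (ℕ.+-identityʳ _)
... | false = refl

length-filter : ∀ {A : Set} {P : A → Set} (P? : Decidable P) xs →
  length (filter P? xs) ≡ sum (map (λ x → χ (P? x)) xs)
length-filter P? []       = refl
length-filter P? (x ∷ xs) with does (P? x)
... | true  = cong suc (length-filter P? xs)
... | false = length-filter P? xs

sum-filter : ∀ {A : Set} {P : A → Set} (P? : Decidable P) (f : A → ℕ) xs →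
  sum (map f (filter P? xs)) ≡ sum (map (λ x → χ (P? x) ℕ.* f x) xs)
sum-filter P? f []       = refl
sum-filter P? f (x ∷ xs) with does (P? x)
... | true  = cong₂ _+_ (sym (ℕ.*-identityˡ (f x))) (sum-filter P? f xs)
... | false = sum-filter P? f xs

sized : Weight → Weight
sized w i ps = w i ps ℕ.* suc (length ps)

-- Repeating the largest part adds one part, so a sized weight gains one unsized copy: the source of
-- the Fibonacci inhomogeneity.
sized-suc : ∀ {x y} n → x ≡ y → x ℕ.* suc n ≡ y ℕ.* n + y
sized-suc {x} n refl = trans (ℕ.*-suc x n) (ℕ.+-comm x _)

-- Partitions into odd parts

even-2+ : ∀ {n} → Even n ⇔ Even (2 + n)
even-2+ = mk⇔ (∣m∣n⇒∣m+n ∣-refl) (λ e → ∣m+n∣m⇒∣n e ∣-refl)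

even-suc⇒odd : ∀ {n} → Even (suc n) → Odd n
even-suc⇒odd {n} e o = contradiction (∣1⇒≡1 (∣m+n∣m⇒∣n (subst Even (ℕ.+-comm 1 n) e) o)) (λ ())

-- `Odd` is a negation, so evenness has to be constructed: descend by two.
odd-suc⇒even : ∀ n → Odd (suc n) → Even n
odd-suc⇒even zero          _ = ∣m+n∣m⇒∣n {m = 2} ∣-refl ∣-refl
odd-suc⇒even (suc zero)    o = contradiction ∣-refl o
odd-suc⇒even (suc (suc n)) o = to even-2+ (odd-suc⇒even n (o ∘ to even-2+))

odd-suc⇔even : ∀ {n} → Odd (suc n) ⇔ Even n
odd-suc⇔even = mk⇔ (odd-suc⇒even _) (λ e o → even-suc⇒odd o e)

odd-2+ : ∀ {n} → Odd (2 + n) ⇔ Odd n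
odd-2+ = mk⇔ (λ o e → o (to even-2+ e)) (λ o e → o (from even-2+ e))

allOdd? : Decidable (All Odd)
allOdd? = All.all? odd?

odds : Weight
odds i ps = χ (allOdd? (suc i ∷ ps))

odds-raise² : raise (raise odds) ≈ʷ odds
odds-raise² i ps _ = χ-cong (allOdd? (3 + i ∷ ps)) (allOdd? (suc i ∷ ps))
  (mk⇔ (λ { (o ∷ os) → to odd-2+ o ∷ os }) (λ { (o ∷ os) → from odd-2+ o ∷ os }))

-- Repeating and then raising leaves two consecutive integers as parts, one of them even.
odds-raise-double : double (raise odds) ≈ʷ 0ʷ
odds-raise-double i ps _ = χ-no (allOdd? (2 + i ∷ suc i ∷ ps)) (λ { (o ∷ o′ ∷ _) → o′ (to odd-suc⇔even o) })

odds-double : double odds ≈ʷ odds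
odds-double i ps _ = χ-cong (allOdd? (suc i ∷ suc i ∷ ps)) (allOdd? (suc i ∷ ps))
  (mk⇔ (λ { (_ ∷ os) → os }) (λ { (o ∷ os) → o ∷ o ∷ os }))

odds-rec : ∀ n → total odds (2 + n) ≡ total odds (1 + n) + total odds n
odds-rec n = trans
  (raise²-double-recurrence {odds} {0ʷ} {0ʷ} odds-raise² odds-raise-double
    (λ i ps ps≤ → trans (odds-double i ps ps≤) (sym (ℕ.+-identityʳ _))) n)
  (trans (cong (_+_ _) (cong₂ _+_ (total-0 n) (total-0 (1 + n)))) (ℕ.+-identityʳ _))

-- Raising keeps the number of parts and repeating increases it by one, so the extra term is the
-- plain count one perimeter lower.
sizedOdds-rec : ∀ n → total (sized odds) (2 + n) ≡
  total (sized odds) (1 + n) + total (sized odds) n + total odds (1 + n)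
sizedOdds-rec n = trans
  (raise²-double-recurrence {sized odds} {0ʷ} {odds}
    (λ i ps ps≤ → cong (ℕ._* suc (length ps)) (odds-raise² i ps ps≤))
    (λ i ps ps≤ → cong (ℕ._* (2 + length ps)) (odds-raise-double i ps ps≤))
    (λ i ps ps≤ → sized-suc (suc (length ps)) (odds-double i ps ps≤)) n)
  (cong (λ z → total (sized odds) (1 + n) + total (sized odds) n + (z + total odds (1 + n))) (total-0 n))

-- Partitions into distinct parts

above∉ : ∀ {m p ps} → All (_≤ m) ps → m < p → p ∉ ps
above∉ ps≤ m<p p∈ = ℕ.<⇒≱ m<p (All.lookup ps≤ p∈)

unique-∷ : ∀ {p} {ps : List ℕ} → p ∉ ps → Unique (p ∷ ps) ⇔ Unique ps
unique-∷ p∉ = mk⇔ (λ { (_ ∷ u) → u }) (¬Any⇒All¬ _ p∉ ∷_)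

∈⇒¬unique : ∀ {p} {ps : List ℕ} → p ∈ ps → ¬ Unique (p ∷ ps)
∈⇒¬unique p∈ (p≢ ∷ _) = All¬⇒¬Any p≢ p∈

distinct : Weight
distinct i ps = χ (unique? (suc i ∷ ps))

distinct-double : double distinct ≈ʷ 0ʷ
distinct-double i ps _ = χ-no (unique? (suc i ∷ suc i ∷ ps)) (∈⇒¬unique (here refl))

-- A head above every part of the tail creates no repetition, however far it is raised.
distinct-raise² : raise (raise distinct) ≈ʷ raise distinct
distinct-raise² i ps ps≤ = χ-cong (unique? (3 + i ∷ ps)) (unique? (2 + i ∷ ps))
  (⇔-sym (unique-∷ (above∉ ps≤ (ℕ.n<1+n (suc i)))) ⇔-∘ unique-∷ (above∉ ps≤ (ℕ.m≤n⇒m≤1+n (ℕ.n<1+n (suc i)))))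

distinct-raise-double : double (raise distinct) ≈ʷ distinct
distinct-raise-double i ps ps≤ = χ-cong (unique? (2 + i ∷ suc i ∷ ps)) (unique? (suc i ∷ ps))
  (unique-∷ (above∉ (ℕ.≤-refl ∷ ps≤) (ℕ.n<1+n (suc i))))

distinct-rec : ∀ n → total distinct (2 + n) ≡ total distinct (1 + n) + total distinct n
distinct-rec n = trans
  (raise-recurrence {distinct} {0ʷ} distinct-double distinct-raise²
    (λ i ps ps≤ → trans (distinct-raise-double i ps ps≤) (sym (ℕ.+-identityʳ _))) n)
  (trans (cong (_+_ _) (total-0 n)) (ℕ.+-identityʳ _))

-- A new part enters by a repeat followed by a raise, so the plain count appears two perimeters
-- lower.
sizedDistinct-rec : ∀ n → total (sized distinct) (2 + n) ≡
  total (sized distinct) (1 + n) + total (sized distinct) n + total distinct n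
sizedDistinct-rec = raise-recurrence {sized distinct} {distinct}
  (λ i ps ps≤ → cong (ℕ._* (2 + length ps)) (distinct-double i ps ps≤))
  (λ i ps ps≤ → cong (ℕ._* suc (length ps)) (distinct-raise² i ps ps≤))
  (λ i ps ps≤ → sized-suc (suc (length ps)) (distinct-raise-double i ps ps≤))

-- Covers both 𝒢₁ and ℋ₁: the largest part is the special value in b, not in a.
special-rec : ∀ (a b f : ℕ → ℕ) →
  (∀ n → a (2 + n) ≡ a (1 + n) + a n + b n) → (∀ n → b (1 + n) ≡ b n + f n) →
  ∀ n → b (2 + n) + a (2 + n) ≡ (b (1 + n) + a (1 + n)) + (b n + a n) + f (1 + n)
special-rec a b f a-rec b-rec n = trans (cong₂ _+_ (b-rec (1 + n)) (a-rec n))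
  (rearrange (b (1 + n)) (f (1 + n)) (a (1 + n)) (a n) (b n))
  where
  rearrange : ∀ b₁ f₁ a₁ a₀ b₀ → (b₁ + f₁) + (a₁ + a₀ + b₀) ≡ (b₁ + a₁) + (b₀ + a₀) + f₁
  rearrange = ℕRing.solve-∀

-- Partitions with one even part value

oneEven-odd∷ : ∀ {p ps} → Odd p → OneEvenPart (p ∷ ps) ⇔ OneEvenPart ps
oneEven-odd∷ {p} {ps} o = mk⇔ ⇒ ⇐
  where
  ⇒ : OneEvenPart (p ∷ ps) → OneEvenPart ps
  ⇒ (_ , here refl , ev , _)    = contradiction ev o
  ⇒ (e , there e∈ , ev , _ ∷ r) = e , e∈ , ev , r
  ⇐ : OneEvenPart ps → OneEvenPart (p ∷ ps)
  ⇐ (e , e∈ , ev , r) = e , there e∈ , ev , (λ _ → o) ∷ r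

-- The even value must be the head: for any other witness the even head would have to be odd.
oneEven-even∷ : ∀ {p ps} → Even p → OneEvenPart (p ∷ ps) ⇔ All (λ q → q ≢ p → Odd q) ps
oneEven-even∷ {p} {ps} ev = mk⇔ ⇒ ⇐
  where
  ⇒ : OneEvenPart (p ∷ ps) → All (λ q → q ≢ p → Odd q) ps
  ⇒ (e , _ , _ , p-odd ∷ r) with p ℕ.≟ e
  ... | yes refl = r
  ... | no p≢e   = contradiction ev (p-odd p≢e)
  ⇐ : All (λ q → q ≢ p → Odd q) ps → OneEvenPart (p ∷ ps)
  ⇐ r = p , here refl , ev , contradiction refl ∷ r

evenTop? : ∀ i ps → Dec (Even (suc i) × OneEvenPart (suc i ∷ ps))
evenTop? i ps = 2 ∣? suc i ×-dec oneEvenPart? (suc i ∷ ps)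

oddTop? : ∀ i ps → Dec (Odd (suc i) × OneEvenPart (suc i ∷ ps))
oddTop? i ps = odd? (suc i) ×-dec oneEvenPart? (suc i ∷ ps)

evenTop oddTop : Weight
evenTop i ps = χ (evenTop? i ps)
oddTop  i ps = χ (oddTop? i ps)

⇔-under : ∀ {A B C : Set} → (A → B ⇔ C) → (A × B) ⇔ (A × C)
⇔-under B⇔C = mk⇔ (λ (a , b) → a , to (B⇔C a) b) (λ (a , c) → a , from (B⇔C a) c)

evenTop-double : double evenTop ≈ʷ evenTop
evenTop-double i ps _ = χ-cong (evenTop? i (suc i ∷ ps)) (evenTop? i ps) (⇔-under λ ev →
  ⇔-sym (oneEven-even∷ ev) ⇔-∘ (mk⇔ (λ { (_ ∷ r) → r }) (contradiction refl ∷_) ⇔-∘ oneEven-even∷ ev))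

-- The raised part exceeds the whole tail, so the even value has no second copy and the tail must be
-- odd; undoing the raise makes the head odd as well.
evenTop-raise : raise evenTop ≈ʷ odds
evenTop-raise i ps ps≤ = χ-cong (evenTop? (suc i) ps) (allOdd? (suc i ∷ ps)) (mk⇔
  (λ (ev , one-even) → even-suc⇒odd ev ∷ All.tabulate (λ q∈ →
    All.lookup (to (oneEven-even∷ ev) one-even) q∈ (λ { refl → above∉ ps≤ (ℕ.n<1+n _) q∈ })))
  (λ { (o ∷ os) → let ev = odd-suc⇒even (2 + i) (from odd-2+ o) in
    ev , from (oneEven-even∷ ev) (All.map (λ o _ → o) os) }))

evenTop-rec : ∀ n → total evenTop (1 + n) ≡ total evenTop n + total odds n
evenTop-rec n = trans (cong₂ _+_ (total-cong evenTop-raise n) (total-cong evenTop-double n)) (ℕ.+-comm (total odds n) _)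

oddTop-double : double oddTop ≈ʷ oddTop
oddTop-double i ps _ = χ-cong (oddTop? i (suc i ∷ ps)) (oddTop? i ps) (⇔-under oneEven-odd∷)

oddTop-raise² : raise (raise oddTop) ≈ʷ oddTop
oddTop-raise² i ps _ = χ-cong (oddTop? (2 + i) ps) (oddTop? i ps)
  (⇔-under (λ o → ⇔-sym (oneEven-odd∷ o)) ⇔-∘ ((odd-2+ ×-⇔ mk⇔ (λ r → r) (λ r → r)) ⇔-∘ ⇔-under oneEven-odd∷))

-- Dropping the odd head `2 + i` leaves a partition whose largest part is even. This is how
-- `evenTop` enters the recurrence for `oddTop`.
oddTop-raise-double : double (raise oddTop) ≈ʷ evenTop
oddTop-raise-double i ps _ = χ-cong (oddTop? (suc i) (suc i ∷ ps)) (evenTop? i ps)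
  ((odd-suc⇔even ×-⇔ mk⇔ (λ r → r) (λ r → r)) ⇔-∘ ⇔-under oneEven-odd∷)

oddTop-rec : ∀ n → total oddTop (2 + n) ≡ total oddTop (1 + n) + total oddTop n + total evenTop n
oddTop-rec n = trans
  (raise²-double-recurrence {oddTop} {evenTop} {0ʷ} oddTop-raise² oddTop-raise-double
    (λ i ps ps≤ → trans (oddTop-double i ps ps≤) (sym (ℕ.+-identityʳ _))) n)
  (cong (_+_ (total oddTop (1 + n) + total oddTop n))
    (trans (cong (_+_ (total evenTop n)) (total-0 (1 + n))) (ℕ.+-identityʳ _)))

-- Partitions with one repeated part value

multiplicity-here : ∀ p ps → multiplicity p (p ∷ ps) ≡ suc (multiplicity p ps)
multiplicity-here p ps = cong length (filter-accept (p ℕ.≟_) {xs = ps} refl)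

multiplicity-there : ∀ {v p} ps → v ≢ p → multiplicity v (p ∷ ps) ≡ multiplicity v ps
multiplicity-there {v} ps v≢p = cong length (filter-reject (v ℕ.≟_) {xs = ps} v≢p)

multiplicity-∉ : ∀ {v ps} → v ∉ ps → multiplicity v ps ≡ 0
multiplicity-∉ {v} v∉ = cong length (filter-none (v ℕ.≟_) (¬Any⇒All¬ _ v∉))

multiplicity-∈∷ : ∀ {p ps} → p ∈ ps → 2 ≤ multiplicity p (p ∷ ps)
multiplicity-∈∷ {p} {ps} p∈ = subst (2 ≤_) (sym (multiplicity-here p ps)) (s≤s (filter-some (p ℕ.≟_) p∈))

multiplicity-∉∷ : ∀ {p ps} → p ∉ ps → multiplicity p (p ∷ ps) ≡ 1
multiplicity-∉∷ {p} {ps} p∉ = trans (multiplicity-here p ps) (cong suc (multiplicity-∉ p∉))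

∈-∉⇒≢ : ∀ {p q : ℕ} {ps} → q ∈ ps → p ∉ ps → q ≢ p
∈-∉⇒≢ q∈ p∉ refl = p∉ q∈

2≰1 : ¬ (2 ≤ 1)
2≰1 (s≤s ())

unique⇒simple : ∀ {ps} → Unique ps → ∀ {q} → q ∈ ps → multiplicity q ps ≡ 1
unique⇒simple (p≢ ∷ _)          (here refl) = multiplicity-∉∷ (All¬⇒¬Any p≢)
unique⇒simple {p ∷ ps} (p≢ ∷ u) (there q∈)  =
  trans (multiplicity-there ps (∈-∉⇒≢ q∈ (All¬⇒¬Any p≢))) (unique⇒simple u q∈)

simple⇒unique : ∀ {ps} → (∀ {q} → q ∈ ps → multiplicity q ps ≡ 1) → Unique ps
simple⇒unique {[]}     _      = []
simple⇒unique {p ∷ ps} simple = ¬Any⇒All¬ ps p∉ ∷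
  simple⇒unique (λ q∈ → trans (sym (multiplicity-there ps (∈-∉⇒≢ q∈ p∉))) (simple (there q∈)))
  where
  p∉ : p ∉ ps
  p∉ p∈ = 2≰1 (subst (2 ≤_) (simple (here refl)) (multiplicity-∈∷ p∈))

SimpleExcept : ℕ → List ℕ → Set
SimpleExcept p ps = All (λ q → q ≢ p → multiplicity q ps ≡ 1) ps

simpleExcept-∷ : ∀ {p ps} → SimpleExcept p (p ∷ ps) ⇔ SimpleExcept p ps
simpleExcept-∷ {p} {ps} = mk⇔
  (λ { (_ ∷ r) → All.map (λ eq q≢ → trans (sym (multiplicity-there ps q≢)) (eq q≢)) r })
  (λ r → contradiction refl ∷ All.map (λ eq q≢ → trans (multiplicity-there ps q≢) (eq q≢)) r)

-- The exemption for `p` is vacuous here, and having every multiplicity equal to 1 amounts to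
-- uniqueness.
simpleExcept-∉ : ∀ {p ps} → p ∉ ps → SimpleExcept p ps ⇔ Unique ps
simpleExcept-∉ p∉ = mk⇔
  (λ r → simple⇒unique (λ q∈ → All.lookup r q∈ (∈-∉⇒≢ q∈ p∉)))
  (λ u → All.tabulate (λ q∈ _ → unique⇒simple u q∈))

-- The recurring head has multiplicity at least 2, so it can only be the repeated value.
oneRepeated-∈∷ : ∀ {p ps} → p ∈ ps → OneRepeatedPart (p ∷ ps) ⇔ SimpleExcept p ps
oneRepeated-∈∷ {p} {ps} p∈ = simpleExcept-∷ ⇔-∘ mk⇔ ⇒ (λ r → p , here refl , multiplicity-∈∷ p∈ , r)
  where
  ⇒ : OneRepeatedPart (p ∷ ps) → SimpleExcept p (p ∷ ps)
  ⇒ (v , _ , _ , r) with p ℕ.≟ v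
  ... | yes refl = r
  ... | no p≢v   = contradiction (subst (2 ≤_) (All.lookup r (here refl) p≢v) (multiplicity-∈∷ p∈)) 2≰1

-- A fresh head has multiplicity 1 and leaves every other multiplicity alone.
oneRepeated-∉∷ : ∀ {p ps} → p ∉ ps → OneRepeatedPart (p ∷ ps) ⇔ OneRepeatedPart ps
oneRepeated-∉∷ {p} {ps} p∉ = mk⇔ ⇒ ⇐
  where
  same : ∀ {q} → q ∈ ps → multiplicity q (p ∷ ps) ≡ multiplicity q ps
  same q∈ = multiplicity-there ps (∈-∉⇒≢ q∈ p∉)
  ⇒ : OneRepeatedPart (p ∷ ps) → OneRepeatedPart ps
  ⇒ (_ , here refl , 2≤ , _)    = contradiction (subst (2 ≤_) (multiplicity-∉∷ p∉) 2≤) 2≰1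
  ⇒ (v , there v∈ , 2≤ , _ ∷ r) = v , v∈ , subst (2 ≤_) (same v∈) 2≤ ,
    All.tabulate (λ q∈ q≢ → trans (sym (same q∈)) (All.lookup r q∈ q≢))
  ⇐ : OneRepeatedPart ps → OneRepeatedPart (p ∷ ps)
  ⇐ (v , v∈ , 2≤ , r) = v , there v∈ , subst (2 ≤_) (sym (same v∈)) 2≤ ,
    (λ _ → multiplicity-∉∷ p∉) ∷ All.tabulate (λ q∈ q≢ → trans (same q∈) (All.lookup r q∈ q≢))

oneRepeated-double : ∀ {p ps} → OneRepeatedPart (p ∷ p ∷ ps) ⇔ SimpleExcept p ps
oneRepeated-double = simpleExcept-∷ ⇔-∘ oneRepeated-∈∷ (here refl)

repeatedTop? : ∀ i ps → Dec (suc i ∈ ps × OneRepeatedPart (suc i ∷ ps))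
repeatedTop? i ps = suc i ∈? ps ×-dec oneRepeatedPart? (suc i ∷ ps)

simpleTop? : ∀ i ps → Dec (suc i ∉ ps × OneRepeatedPart (suc i ∷ ps))
simpleTop? i ps = ¬? (suc i ∈? ps) ×-dec oneRepeatedPart? (suc i ∷ ps)

repeatedTop simpleTop : Weight
repeatedTop i ps = χ (repeatedTop? i ps)
simpleTop   i ps = χ (simpleTop? i ps)

repeatedTop-raise : raise repeatedTop ≈ʷ 0ʷ
repeatedTop-raise i ps ps≤ = χ-no (repeatedTop? (suc i) ps)
  (λ (q∈ , _) → above∉ ps≤ (ℕ.n<1+n _) q∈)

-- Once doubled, the largest part is the repeated value and all others must be simple. Either it
-- recurred before, or the partition was distinct; each case makes one summand vanish.
repeatedTop-double : double repeatedTop ≈ʷ (repeatedTop +ʷ distinct)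
repeatedTop-double i ps _ = by-cases (suc i ∈? ps)
  where
  dd? = repeatedTop? i (suc i ∷ ps)
  d?  = repeatedTop? i ps
  u?  = unique? (suc i ∷ ps)
  by-cases : Dec (suc i ∈ ps) → χ dd? ≡ χ d? + χ u?
  by-cases (yes p∈) = trans
    (χ-cong dd? d? (mk⇔
      (λ (_ , r) → p∈ , from (oneRepeated-∈∷ p∈) (to oneRepeated-double r))
      (λ (_ , r) → here refl , from oneRepeated-double (to (oneRepeated-∈∷ p∈) r))))
    (trans (sym (ℕ.+-identityʳ _)) (cong (λ z → χ d? + z) (sym (χ-no u? (∈⇒¬unique p∈)))))
  by-cases (no p∉) = trans
    (χ-cong dd? u? (mk⇔
      (λ (_ , r) → from (unique-∷ p∉) (to (simpleExcept-∉ p∉) (to oneRepeated-double r)))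
      (λ u → here refl , from oneRepeated-double (from (simpleExcept-∉ p∉) (to (unique-∷ p∉) u)))))
    (cong (_+ χ u?) (sym (χ-no d? (λ (p∈ , _) → p∉ p∈))))

repeatedTop-rec : ∀ n → total repeatedTop (1 + n) ≡ total repeatedTop n + total distinct n
repeatedTop-rec n = cong₂ _+_ (trans (total-cong repeatedTop-raise n) (total-0 n))
  (trans (total-cong repeatedTop-double n) (total-+ repeatedTop distinct n))

simpleTop-double : double simpleTop ≈ʷ 0ʷ
simpleTop-double i ps _ = χ-no (simpleTop? i (suc i ∷ ps))
  (λ (p∉ , _) → p∉ (here refl))

-- A fresh head does not affect the condition, so the value depends on the tail alone.
simpleTop-above : ∀ {i ps} → suc i ∉ ps → simpleTop i ps ≡ χ (oneRepeatedPart? ps)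
simpleTop-above {i} {ps} p∉ = χ-cong (simpleTop? i ps) (oneRepeatedPart? ps)
  (mk⇔ (λ (_ , r) → to (oneRepeated-∉∷ p∉) r) (λ r → p∉ , from (oneRepeated-∉∷ p∉) r))

simpleTop-raise² : raise (raise simpleTop) ≈ʷ raise simpleTop
simpleTop-raise² i ps ps≤ = trans (simpleTop-above (above∉ ps≤ (ℕ.m≤n⇒m≤1+n (ℕ.n<1+n (suc i)))))
  (sym (simpleTop-above (above∉ ps≤ (ℕ.n<1+n (suc i)))))

-- Below the fresh head, the full condition is tested on `suc i ∷ ps`, which splits by whether
-- `suc i` recurs in `ps`.
simpleTop-raise-double : double (raise simpleTop) ≈ʷ (simpleTop +ʷ repeatedTop)
simpleTop-raise-double i ps ps≤ = trans (simpleTop-above (above∉ (ℕ.≤-refl ∷ ps≤) (ℕ.n<1+n (suc i))))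
  (trans (χ-split (suc i ∈? ps) (oneRepeatedPart? (suc i ∷ ps))) (ℕ.+-comm (repeatedTop i ps) _))

simpleTop-rec : ∀ n → total simpleTop (2 + n) ≡ total simpleTop (1 + n) + total simpleTop n + total repeatedTop n
simpleTop-rec = raise-recurrence {simpleTop} {repeatedTop} simpleTop-double simpleTop-raise² simpleTop-raise-double

-- The four counting functions as totals

g-total : ∀ n → g (suc n) ≡ total (sized odds) n
g-total n = trans (sum-filter allOdd? length (ofPerimeter (suc n))) (sum-ofPerimeter _ n)

h-total : ∀ n → h (suc n) ≡ total (sized distinct) n
h-total n = trans (sum-filter unique? length (ofPerimeter (suc n))) (sum-ofPerimeter _ n)

g₁-total : ∀ n → g₁ (suc n) ≡ total evenTop n + total oddTop n
g₁-total n = begin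
  g₁ (suc n)                                             ≡⟨ length-filter oneEvenPart? (ofPerimeter (suc n)) ⟩
  sum (map (λ ps → χ (oneEvenPart? ps)) (ofPerimeter (suc n)))    ≡⟨ sum-ofPerimeter _ n ⟩
  total (λ i ps → χ (oneEvenPart? (suc i ∷ ps))) n       ≡⟨ total-cong (λ i ps _ → χ-split (2 ∣? suc i) (oneEvenPart? (suc i ∷ ps))) n ⟩
  total (evenTop +ʷ oddTop) n                            ≡⟨ total-+ evenTop oddTop n ⟩
  total evenTop n + total oddTop n                       ∎
  where open ≡-Reasoning

h₁-total : ∀ n → h₁ (suc n) ≡ total repeatedTop n + total simpleTop n
h₁-total n = begin
  h₁ (suc n)                                             ≡⟨ length-filter oneRepeatedPart? (ofPerimeter (suc n)) ⟩
  sum (map (λ ps → χ (oneRepeatedPart? ps)) (ofPerimeter (suc n))) ≡⟨ sum-ofPerimeter _ n ⟩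
  total (λ i ps → χ (oneRepeatedPart? (suc i ∷ ps))) n   ≡⟨ total-cong (λ i ps _ → χ-split (suc i ∈? ps) (oneRepeatedPart? (suc i ∷ ps))) n ⟩
  total (repeatedTop +ʷ simpleTop) n                     ≡⟨ total-+ repeatedTop simpleTop n ⟩
  total repeatedTop n + total simpleTop n                ∎
  where open ≡-Reasoning

-- Power series

∑≤-cong : ∀ n {φ ψ : ℕ → ℤ} → (∀ k → φ k ≡ ψ k) → ∑≤ n φ ≡ ∑≤ n ψ
∑≤-cong zero    eq = eq 0
∑≤-cong (suc n) eq = cong₂ ℤ._+_ (eq 0) (∑≤-cong n (eq ∘ suc))

*-congʳ : ∀ {F G} K → F ≗ G → F * K ≗ G * K
*-congʳ K F≗G n = ∑≤-cong n (λ k → cong (ℤ._* K (n ∸ k)) (F≗G k))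

-- Strong induction: the coefficient of `G * R` at `suc n` is `R (suc n)`, because `G 0` is 1, plus
-- terms in earlier coefficients, which agree and cancel.
quotient-unique : ∀ F G {G₀ : True (G 0 ℤ.≟ 1ℤ)} R → G * R ≗ F → R ≗ _/_ F G {G₀}
quotient-unique F G {G₀} R G*R≗F = <-rec (λ n → R n ≡ Q n) step
  where
  Q : PowerSeries
  Q = _/_ F G {G₀}
  product-eq : ∀ n → (G * R) n ≡ (G * Q) n
  product-eq n = trans (G*R≗F n) (sym (/-correct F G {G₀} n))
  unit : ∀ x → G 0 ℤ.* x ≡ x
  unit x = trans (cong (ℤ._* x) (toWitness G₀)) (ℤ.*-identityˡ x)
  step : ∀ n → (∀ {m} → m < n → R m ≡ Q m) → R n ≡ Q n
  step zero    _  = trans (sym (unit (R 0))) (trans (product-eq 0) (unit (Q 0)))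
  step (suc n) ih = trans (sym (unit (R (suc n)))) (trans leading (unit (Q (suc n))))
    where
    lower : PowerSeries → ℤ
    lower S = ((G ∘ suc) * S) n
    lower-eq : lower R ≡ lower Q
    lower-eq = ∑≤-cong n (λ k → cong (G (suc k) ℤ.*_) (ih (s≤s (ℕ.m∸n≤m n k))))
    leading : G 0 ℤ.* R (suc n) ≡ G 0 ℤ.* Q (suc n)
    leading = ∙-cancelʳ (AbelianGroup.group ℤ.+-0-abelianGroup) (lower Q) _ _
      (trans (cong (λ z → G 0 ℤ.* R (suc n) ℤ.+ z) (sym lower-eq)) (product-eq (suc n)))

-- With a coefficient list, the leading terms of a product unfold by computation and leave a
-- `poly []` tail.
poly : List ℤ → PowerSeries
poly []       _       = 0ℤ
poly (c ∷ cs) zero    = c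
poly (c ∷ cs) (suc n) = poly cs n

poly[]* : ∀ K n → (poly [] * K) n ≡ 0ℤ
poly[]* K zero    = refl
poly[]* K (suc n) = trans (ℤ.+-identityˡ _) (poly[]* K n)

X* : ∀ F n → (X * F) (suc n) ≡ F n
X* F zero    = trans (ℤ.+-identityˡ _) (ℤ.*-identityˡ (F 0))
X* F (suc n) = begin
  -- From index 2 on `X` computes to 0, so the rest of the product already is `poly [] * F`.
  0ℤ ℤ.+ (1ℤ ℤ.* F (suc n) ℤ.+ (poly [] * F) n)   ≡⟨ ℤ.+-identityˡ _ ⟩
  1ℤ ℤ.* F (suc n) ℤ.+ (poly [] * F) n            ≡⟨ cong₂ ℤ._+_ (ℤ.*-identityˡ (F (suc n))) (poly[]* F n) ⟩
  F (suc n) ℤ.+ 0ℤ                                ≡⟨ ℤ.+-identityʳ _ ⟩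
  F (suc n)                                       ∎
  where open ≡-Reasoning

X²-high : ∀ n → (X ^ 2) (3 + n) ≡ 0ℤ
X²-high n = trans (X* (X ^ 1) (2 + n)) (X* one (1 + n))

X³-high : ∀ n → (X ^ 3) (4 + n) ≡ 0ℤ
X³-high n = trans (X* (X ^ 2) (3 + n)) (X²-high n)

-- The denominator and its square

D : PowerSeries
D = one - X - X ^ 2

D≗poly : D ≗ poly (1ℤ ∷ -1ℤ ∷ -1ℤ ∷ [])
D≗poly 0 = refl
D≗poly 1 = refl
D≗poly 2 = refl
D≗poly (suc (suc (suc n))) = cong (λ z → 0ℤ ℤ.- 0ℤ ℤ.- z) (X²-high n)

D*-high : ∀ K n → (D * K) (3 + n) ≡ K (3 + n) ℤ.- K (2 + n) ℤ.- K (1 + n)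
D*-high K n = begin
  (D * K) (3 + n)                                         ≡⟨ *-congʳ K D≗poly (3 + n) ⟩
  1ℤ ℤ.* K (3 + n) ℤ.+ (-1ℤ ℤ.* K (2 + n) ℤ.+ (-1ℤ ℤ.* K (1 + n) ℤ.+ (poly [] * K) n))
    ≡⟨ cong (λ z → 1ℤ ℤ.* K (3 + n) ℤ.+ (-1ℤ ℤ.* K (2 + n) ℤ.+ (-1ℤ ℤ.* K (1 + n) ℤ.+ z))) (poly[]* K n) ⟩
  1ℤ ℤ.* K (3 + n) ℤ.+ (-1ℤ ℤ.* K (2 + n) ℤ.+ (-1ℤ ℤ.* K (1 + n) ℤ.+ 0ℤ))
    ≡⟨ simplify (K (3 + n)) (K (2 + n)) (K (1 + n)) ⟩
  K (3 + n) ℤ.- K (2 + n) ℤ.- K (1 + n) ∎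
  where
  open ≡-Reasoning
  simplify : ∀ x y z → 1ℤ ℤ.* x ℤ.+ (-1ℤ ℤ.* y ℤ.+ (-1ℤ ℤ.* z ℤ.+ 0ℤ)) ≡ x ℤ.- y ℤ.- z
  simplify = ℤRing.solve-∀

D¹-high : ∀ n → (D ^ 1) (3 + n) ≡ 0ℤ
D¹-high = D*-high one

D²≗poly : D ^ 2 ≗ poly (1ℤ ∷ ℤ.- + 2 ∷ -1ℤ ∷ + 2 ∷ 1ℤ ∷ [])
D²≗poly 0 = refl
D²≗poly 1 = refl
D²≗poly 2 = refl
D²≗poly 3 = refl
D²≗poly 4 = refl
-- The three coefficients of `D ^ 1` involved have index at least 3, where they vanish.
D²≗poly (suc (suc (suc (suc (suc n))))) = trans (D*-high (D ^ 1) (2 + n))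
  (cong₂ ℤ._-_ (cong₂ ℤ._-_ (D¹-high (2 + n)) (D¹-high (1 + n))) (D¹-high n))

-- The numerator is read off by multiplying the first five terms by (1 - x - x²)².
numerator : (u₀ u₁ s₀ s₁ : ℤ) → PowerSeries
numerator u₀ u₁ s₀ s₁ =
  poly (0ℤ ∷ u₀ ∷ u₁ ℤ.- + 2 ℤ.* u₀ ∷ s₀ ℤ.- u₁ ∷ (s₁ ℤ.- s₀) ℤ.- (u₁ ℤ.- u₀) ∷ [])

-- One factor `D` reduces the series of `u` to that of `s` up to finitely many terms, and the second
-- annihilates the latter; both are applied at once as a polynomial with five coefficients.
module _ (a u s : ℕ → ℕ) (a≡u : ∀ n → a (suc n) ≡ u n)
         (u-rec : ∀ n → u (2 + n) ≡ u (1 + n) + u n + s n)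
         (s-rec : ∀ n → s (2 + n) ≡ s (1 + n) + s n) where

  private
    R : PowerSeries
    R = ∑≥1 a

    N : PowerSeries
    N = numerator (+ u 0) (+ u 1) (+ s 0) (+ s 1)

    R-suc : ∀ n → R (suc n) ≡ + u n
    R-suc n = cong +_ (a≡u n)

    -- `R₃`, `R₄` and `R₅` express coefficients through `u n`, `u (1 + n)`, `s n` and `s (1 + n)`
    -- alone, so that the ring solver faces an identity in at most four free variables.
    R₃ : ∀ n → R (3 + n) ≡ + u (1 + n) ℤ.+ + u n ℤ.+ + s n
    R₃ n = trans (R-suc (2 + n)) (cong +_ (u-rec n))

    R₄ : ∀ n → R (4 + n) ≡ (+ u (1 + n) ℤ.+ + u n ℤ.+ + s n) ℤ.+ + u (1 + n) ℤ.+ + s (1 + n)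
    R₄ n = trans (R₃ (1 + n)) (cong (λ z → + (z + u (1 + n) + s (1 + n))) (u-rec n))

    R₅ : ∀ n → R (5 + n) ≡ ((+ u (1 + n) ℤ.+ + u n ℤ.+ + s n) ℤ.+ + u (1 + n) ℤ.+ + s (1 + n))
                           ℤ.+ (+ u (1 + n) ℤ.+ + u n ℤ.+ + s n) ℤ.+ (+ s (1 + n) ℤ.+ + s n)
    R₅ n = trans (R₃ (2 + n)) (cong₂ ℤ._+_ (cong₂ ℤ._+_
      (trans (sym (R-suc (3 + n))) (R₄ n)) (cong +_ (u-rec n))) (cong +_ (s-rec n)))

    window : ℤ → ℤ → ℤ → ℤ → ℤ
    window e d c z = 1ℤ ℤ.* e ℤ.+ (ℤ.- + 2 ℤ.* d ℤ.+ (-1ℤ ℤ.* c ℤ.+ z))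

    window-cong : ∀ {e e′ d d′ c c′ z z′} → e ≡ e′ → d ≡ d′ → c ≡ c′ → z ≡ z′ → window e d c z ≡ window e′ d′ c′ z′
    window-cong refl refl refl refl = refl

    D²*R : poly (1ℤ ∷ ℤ.- + 2 ∷ -1ℤ ∷ + 2 ∷ 1ℤ ∷ []) * R ≗ N
    D²*R 0 = refl
    D²*R 1 = trans (cong (λ x → 1ℤ ℤ.* x ℤ.+ 0ℤ) (R-suc 0)) (solved (+ u 0))
      where
      solved : ∀ x → 1ℤ ℤ.* x ℤ.+ 0ℤ ≡ x
      solved = ℤRing.solve-∀
    D²*R 2 = trans (cong₂ (λ y x → 1ℤ ℤ.* y ℤ.+ (ℤ.- + 2 ℤ.* x ℤ.+ 0ℤ)) (R-suc 1) (R-suc 0)) (solved (+ u 1) (+ u 0))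
      where
      solved : ∀ y x → 1ℤ ℤ.* y ℤ.+ (ℤ.- + 2 ℤ.* x ℤ.+ 0ℤ) ≡ y ℤ.- + 2 ℤ.* x
      solved = ℤRing.solve-∀
    D²*R 3 = trans (window-cong (R₃ 0) (R-suc 1) (R-suc 0) refl) (solved (+ u 1) (+ u 0) (+ s 0))
      where
      solved : ∀ y x p → 1ℤ ℤ.* (y ℤ.+ x ℤ.+ p) ℤ.+ (ℤ.- + 2 ℤ.* y ℤ.+ (-1ℤ ℤ.* x ℤ.+ 0ℤ)) ≡ p ℤ.- y
      solved = ℤRing.solve-∀
    D²*R 4 = trans
      (window-cong (R₄ 0) (R₃ 0) (R-suc 1) (cong (λ x → + 2 ℤ.* x ℤ.+ 0ℤ) (R-suc 0)))
      (solved (+ u 1) (+ u 0) (+ s 0) (+ s 1))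
      where
      solved : ∀ y x p q →
        1ℤ ℤ.* (y ℤ.+ x ℤ.+ p ℤ.+ y ℤ.+ q) ℤ.+ (ℤ.- + 2 ℤ.* (y ℤ.+ x ℤ.+ p) ℤ.+ (-1ℤ ℤ.* y ℤ.+ (+ 2 ℤ.* x ℤ.+ 0ℤ)))
        ≡ (q ℤ.- p) ℤ.- (y ℤ.- x)
      solved = ℤRing.solve-∀
    -- From index 5 on all five coefficients of the squared denominator are in play, and the
    -- recurrences make the sum vanish.
    D²*R (suc (suc (suc (suc (suc n))))) = trans
      (window-cong (R₅ n) (R₄ n) (R₃ n)
        (cong₂ (λ y z → + 2 ℤ.* y ℤ.+ z) (R-suc (1 + n))
          (cong₂ (λ x z → 1ℤ ℤ.* x ℤ.+ z) (R-suc n) (poly[]* R n))))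
      (solved (+ u (1 + n)) (+ u n) (+ s n) (+ s (1 + n)))
      where
      solved : ∀ y x p q →
        1ℤ ℤ.* ((y ℤ.+ x ℤ.+ p ℤ.+ y ℤ.+ q) ℤ.+ (y ℤ.+ x ℤ.+ p) ℤ.+ (q ℤ.+ p)) ℤ.+
        (ℤ.- + 2 ℤ.* (y ℤ.+ x ℤ.+ p ℤ.+ y ℤ.+ q) ℤ.+
        (-1ℤ ℤ.* (y ℤ.+ x ℤ.+ p) ℤ.+ (+ 2 ℤ.* y ℤ.+ (1ℤ ℤ.* x ℤ.+ 0ℤ)))) ≡ 0ℤ
      solved = ℤRing.solve-∀

  recurrence⇒quotient : ∀ F → F ≗ N → ∑≥1 a ≗ F / D ^ 2
  recurrence⇒quotient F F≗N = quotient-unique F (D ^ 2) R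
    (λ n → trans (*-congʳ R D²≗poly n) (trans (D²*R n) (sym (F≗N n))))

-- The four generating functions

g-series : ∑≥1 g ≗ (X - X ^ 3) / D ^ 2
g-series = recurrence⇒quotient g (total (sized odds)) (total odds ∘ suc) g-total sizedOdds-rec (odds-rec ∘ suc) _ F≗N
  where
  -- The arguments are `total (sized odds)` at 0 and 1, then `total odds` at 1 and 2.
  F≗N : X - X ^ 3 ≗ numerator (+ 1) (+ 2) (+ 1) (+ 2)
  F≗N 0 = refl
  F≗N 1 = refl
  F≗N 2 = refl
  F≗N 3 = refl
  F≗N 4 = refl
  F≗N (suc (suc (suc (suc (suc n))))) = cong (λ z → 0ℤ ℤ.- z) (X³-high (1 + n))

h-series : ∑≥1 h ≗ (X - X ^ 2) / D ^ 2
h-series = recurrence⇒quotient h (total (sized distinct)) (total distinct) h-total sizedDistinct-rec distinct-rec _ F≗N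
  where
  F≗N : X - X ^ 2 ≗ numerator (+ 1) (+ 1) (+ 1) (+ 1)
  F≗N 0 = refl
  F≗N 1 = refl
  F≗N 2 = refl
  F≗N 3 = refl
  F≗N 4 = refl
  F≗N (suc (suc (suc (suc (suc n))))) = cong (λ z → 0ℤ ℤ.- z) (X²-high (2 + n))

-- Serves both remaining families: their counts start 0, 1 and their inhomogeneities 1, 2.
X²≗numerator : X ^ 2 ≗ numerator (+ 0) (+ 1) (+ 1) (+ 2)
X²≗numerator 0 = refl
X²≗numerator 1 = refl
X²≗numerator 2 = refl
X²≗numerator 3 = refl
X²≗numerator 4 = refl
X²≗numerator (suc (suc (suc (suc (suc n))))) = X²-high (2 + n)

g₁-series : ∑≥1 g₁ ≗ X ^ 2 / D ^ 2
g₁-series = recurrence⇒quotient g₁ _ (total odds ∘ suc) g₁-total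
  (special-rec (total oddTop) (total evenTop) (total odds) oddTop-rec evenTop-rec) (odds-rec ∘ suc) _ X²≗numerator

h₁-series : ∑≥1 h₁ ≗ X ^ 2 / D ^ 2
h₁-series = recurrence⇒quotient h₁ _ (total distinct ∘ suc) h₁-total
  (special-rec (total simpleTop) (total repeatedTop) (total distinct) simpleTop-rec repeatedTop-rec)
  (distinct-rec ∘ suc) _ X²≗numerator

mainTheorem3 : (∑≥1 g ≗ (X - X ^ 3) / (one - X - X ^ 2) ^ 2) ×
    (∑≥1 h ≗ (X - X ^ 2) / (one - X - X ^ 2) ^ 2) ×
    (∑≥1 g₁ ≗ X ^ 2 / (one - X - X ^ 2) ^ 2) ×
    (X ^ 2 / (one - X - X ^ 2) ^ 2 ≗ ∑≥1 h₁) ×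
    (∀ (M : ℕ) → M ≥ 1 → g₁ M ≡ h₁ M)
mainTheorem3 = g-series , h-series , g₁-series , (λ n → sym (h₁-series n)) ,
  -- Both counts, as integers, are the same coefficient of one quotient.
  λ { (suc n) _ → ℤ.+-injective (trans (g₁-series (suc n)) (sym (h₁-series (suc n)))) }
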